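{- Let $\mathbb{N}=\{0,1,2,\dots\}$ and let $P(x_1,\dots,x_n)$ be a homogeneous polynomial with integer coefficients. The following are equivalent: (i) $P(x_1,\dots,x_n)$ is partition regular, i.e. the equation $P(x_1,\dots,x_n)=0$ is partition regular; (ii) for every piecewise syndetic set $A$ in $(\mathbb{N},\cdot)$ there exist $a_1,\dots,a_n\in A$ such that $P(a_1,\dots,a_n)=0$.
   Context: The equation $P(x_1,\dots,x_n)=0$ is partition regular if for every finite partition $\mathbb{N}=A_1\cup\dots\cup A_m$ there are an index $i\leq m$ and elements $a_1,\dots,a_n\in A_i\setminus\{0\}$ such that $P(a_1,\dots,a_n)=0$. A set $A\subseteq\mathbb{N}$ is piecewise syndetic in $(\mathbb{N},\cdot)$ if there is a finite nonempty $G\subseteq\mathbb{N}$ such that for every finite $F\subseteq\mathbb{N}$ there is $x\in\mathbb{N}$ with $F\cdot x\subseteq\bigcup_{t\in G}\{m\in\mathbb{N}\mid tm\in A\}$.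
   Formalization: Piecewise syndetic sets are taken in the multiplicative semigroup of nonzero naturals (G, F, x avoid 0) and the a_i in (ii) must be nonzero; with 0 allowed, piecewise syndetic just means 0 ∈ A and x − 2y satisfies (ii) but not (i). -}

module Defs where

open import Data.Nat as ℕ using (ℕ; NonZero)
open import Data.Integer as ℤ using (ℤ; +_; 0ℤ; 1ℤ)
open import Data.Fin using (Fin)
open import Data.List as List using (List; [])
import Data.List.Membership.Propositional as ListMem
open import Data.List.Relation.Unary.All using (All)
open import Data.List.Relation.Unary.Any using (Any)
open import Data.List.Relation.Unary.Unique.Propositional using (Unique)
open import Data.Vec as Vec using (Vec)
import Data.Vec.Relation.Unary.All as VecAll
open import Data.Product using (∃; ∃-syntax; _×_)
open import Level using (0ℓ)
open import Relation.Binary.PropositionalEquality using (_≡_; _≢_)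
open import Relation.Unary using (Pred; _∈_)

-- Integer polynomials in n variables, as finitely supported functions from
-- exponent vectors to ℤ.  The support list may also contain exponents whose
-- coefficient is zero.
record Polynomial (n : ℕ) : Set where
  field
    coeff   : Vec ℕ n → ℤ
    support : List (Vec ℕ n)
    unique  : Unique support
    outside : ∀ e → e ListMem.∉ support → coeff e ≡ 0ℤ

open Polynomial public

monomial : ∀ {n} → Vec ℕ n → Vec ℤ n → ℤ
monomial e x = Vec.foldr′ ℤ._*_ 1ℤ (Vec.zipWith ℤ._^_ x e)

eval : ∀ {n} → Polynomial n → Vec ℤ n → ℤ
eval P x = List.foldr ℤ._+_ 0ℤ
  (List.map (λ e → coeff P e ℤ.* monomial e x) (support P))

-- The zero polynomial is homogeneous (of every degree).
Homogeneous : ∀ {n} → Polynomial n → Set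
Homogeneous P = ∃[ d ] (∀ e → coeff P e ≢ 0ℤ → Vec.sum e ≡ d)

HasSolutionIn : ∀ {n} → Polynomial n → Pred ℕ 0ℓ → Set
HasSolutionIn {n} P A =
  ∃ λ (a : Vec ℕ n) →
    VecAll.All (λ k → k ∈ A × NonZero k) a × eval P (Vec.map +_ a) ≡ 0ℤ

-- Cells are allowed to be empty.
record IsPartition {m : ℕ} (A : Fin m → Pred ℕ 0ℓ) : Set where
  field
    cover    : ∀ k → ∃[ i ] k ∈ A i
    disjoint : ∀ {i j k} → k ∈ A i → k ∈ A j → i ≡ j

PartitionRegular : ∀ {n} → Polynomial n → Set₁
PartitionRegular P =
  ∀ {m} (A : Fin m → Pred ℕ 0ℓ) → IsPartition A → ∃[ i ] HasSolutionIn P (A i)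

-- Piecewise syndeticity of A ∖ {0} in the multiplicative semigroup of nonzero
-- naturals; finite sets are lists.  The absorbing element 0 has to be left
-- out: with 0 ∈ F allowed, every piecewise syndetic set would contain 0, and
-- with x = 0 allowed, every set containing 0 would be piecewise syndetic.
PiecewiseSyndetic : Pred ℕ 0ℓ → Set
PiecewiseSyndetic A =
  ∃ λ (G : List ℕ) → G ≢ [] × All NonZero G ×
    (∀ (F : List ℕ) → All NonZero F →
      ∃ λ x → NonZero x ×
        All (λ f → Any (λ t → t ℕ.* (f ℕ.* x) ∈ A) G) F)

{-# OPTIONS --safe #-}
-- (ii) ⇒ (i): piecewise syndeticity passes to one of the two sets of a union,
-- so some cell of any finite partition of ℕ is piecewise syndetic.
-- (i) ⇒ (ii): if A is piecewise syndetic via G, every initial segment {1,…,M}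
-- has a dilate {1,…,M}·x in which each k·x lies in t⁻¹A for some t ∈ G, and
-- choosing t colours {1,…,M} with |G| colours.  By compactness these colourings
-- have a limit χ.  A χ-monochromatic solution of P is monochromatic for one of
-- the finite colourings, and dilating it by t·x gives, by homogeneity, a
-- solution in A.
module Submission where

open import Data.Nat using (ℕ)
open import Level using (0ℓ)
open import Relation.Unary using (Pred)
open import Axiom.ExcludedMiddle using (ExcludedMiddle)
open import Function.Bundles using (_⇔_)
open import Defs
open import Algebra.Properties.CommutativeSemigroup using (interchange)
open import Data.Empty using (⊥-elim)
open import Data.Fin using (Fin; zero; suc)
open import Data.Integer as ℤ using (ℤ; +_; 0ℤ)
import Data.Integer.Properties as ℤₚ
open import Data.List as List using (List; []; _∷_)
open import Data.List.Membership.Propositional using (find; lose) renaming (_∈_ to _∈ₗ_)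
open import Data.List.Membership.Propositional.Properties
  using (∈-lookup; ∈-applyUpTo⁺; ∈-cartesianProductWith⁺; ∈-cartesianProductWith⁻)
open import Data.List.Relation.Unary.All as All using (All; []; _∷_)
import Data.List.Relation.Unary.All.Properties as Allₚ
open import Data.List.Relation.Unary.Any as Any using (Any; here)
import Data.List.Relation.Unary.Any.Properties as Anyₚ
open import Data.Nat as ℕ using (zero; suc; NonZero; _≤_; _<_; s≤s)
import Data.Nat.Properties as ℕₚ
open import Data.Product using (Σ; ∃; ∃-syntax; _×_; _,_; proj₁; proj₂)
open import Data.Sum using (_⊎_; inj₁; inj₂)
open import Data.Unit using (tt)
open import Data.Vec as Vec using (Vec; []; _∷_)
import Data.Vec.Properties as Vecₚ
open import Data.Vec.Relation.Unary.All as VecAll using ([]; _∷_)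
import Data.Vec.Relation.Unary.All.Properties as VecAllₚ
open import Function using (_∘_; case_of_)
open import Function.Bundles using (mk⇔)
open import Relation.Binary.PropositionalEquality
open import Relation.Nullary using (¬_; Dec; yes; no)
open import Relation.Unary using (_∈_; _∪_; _∩_; _⊆_; ∅; U)

open ≡-Reasoning

private
  variable
    n g : ℕ

-- Scaling the roots of a homogeneous polynomial.

^-distribʳ-* : ∀ i j k → (i ℤ.* j) ℤ.^ k ≡ i ℤ.^ k ℤ.* j ℤ.^ k
^-distribʳ-* i j zero    = refl
^-distribʳ-* i j (suc k) = begin
  i ℤ.* j ℤ.* (i ℤ.* j) ℤ.^ k            ≡⟨ cong (i ℤ.* j ℤ.*_) (^-distribʳ-* i j k) ⟩
  i ℤ.* j ℤ.* (i ℤ.^ k ℤ.* j ℤ.^ k)      ≡⟨ interchange ℤₚ.*-commutativeSemigroup i j _ _ ⟩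
  i ℤ.* i ℤ.^ k ℤ.* (j ℤ.* j ℤ.^ k)      ∎

monomial-scale : ∀ s (e : Vec ℕ n) x →
  monomial e (Vec.map (s ℤ.*_) x) ≡ s ℤ.^ Vec.sum e ℤ.* monomial e x
monomial-scale s []      []      = refl
monomial-scale s (k ∷ e) (y ∷ x) = begin
  (s ℤ.* y) ℤ.^ k ℤ.* monomial e (Vec.map (s ℤ.*_) x)
    ≡⟨ cong₂ ℤ._*_ (^-distribʳ-* s y k) (monomial-scale s e x) ⟩
  s ℤ.^ k ℤ.* y ℤ.^ k ℤ.* (s ℤ.^ Vec.sum e ℤ.* monomial e x)
    ≡⟨ interchange ℤₚ.*-commutativeSemigroup (s ℤ.^ k) _ _ _ ⟩
  s ℤ.^ k ℤ.* s ℤ.^ Vec.sum e ℤ.* (y ℤ.^ k ℤ.* monomial e x)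
    ≡⟨ cong (ℤ._* _) (ℤₚ.^-distribˡ-+-* s k (Vec.sum e)) ⟨
  s ℤ.^ (k ℕ.+ Vec.sum e) ℤ.* (y ℤ.^ k ℤ.* monomial e x) ∎

module _ (P : Polynomial n) (d : ℕ) (hom : ∀ e → coeff P e ≢ 0ℤ → Vec.sum e ≡ d) where

  term-scale : ∀ s x e →
    coeff P e ℤ.* monomial e (Vec.map (s ℤ.*_) x) ≡ s ℤ.^ d ℤ.* (coeff P e ℤ.* monomial e x)
  -- Homogeneity constrains only exponents with nonzero coefficient, while `support P` may list
  -- others; for those both sides vanish.
  term-scale s x e with coeff P e ℤ.≟ 0ℤ
  ... | yes c≡0 rewrite c≡0 = sym (ℤₚ.*-zeroʳ (s ℤ.^ d))
  ... | no  c≢0 = begin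
    coeff P e ℤ.* monomial e (Vec.map (s ℤ.*_) x)
      ≡⟨ cong (coeff P e ℤ.*_) (monomial-scale s e x) ⟩
    coeff P e ℤ.* (s ℤ.^ Vec.sum e ℤ.* monomial e x)
      ≡⟨ cong (λ k → coeff P e ℤ.* (s ℤ.^ k ℤ.* monomial e x)) (hom e c≢0) ⟩
    coeff P e ℤ.* (s ℤ.^ d ℤ.* monomial e x)
      ≡⟨ ℤ*.x∙yz≈y∙xz (coeff P e) (s ℤ.^ d) (monomial e x) ⟩
    s ℤ.^ d ℤ.* (coeff P e ℤ.* monomial e x) ∎
    where
    import Algebra.Properties.CommutativeSemigroup ℤₚ.*-commutativeSemigroup as ℤ*

  eval-scale : ∀ s x → eval P (Vec.map (s ℤ.*_) x) ≡ s ℤ.^ d ℤ.* eval P x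
  eval-scale s x = go (support P)
    where
    go : ∀ es →
      List.foldr ℤ._+_ 0ℤ (List.map (λ e → coeff P e ℤ.* monomial e (Vec.map (s ℤ.*_) x)) es) ≡
      s ℤ.^ d ℤ.* List.foldr ℤ._+_ 0ℤ (List.map (λ e → coeff P e ℤ.* monomial e x) es)
    go []       = sym (ℤₚ.*-zeroʳ (s ℤ.^ d))
    go (e ∷ es) = trans (cong₂ ℤ._+_ (term-scale s x e) (go es))
                        (sym (ℤₚ.*-distribˡ-+ (s ℤ.^ d) _ _))

  scaled-root : ∀ s (a : Vec ℕ n) → eval P (Vec.map +_ a) ≡ 0ℤ →
    eval P (Vec.map +_ (Vec.map (s ℕ.*_) a)) ≡ 0ℤ
  scaled-root s a root = begin
    eval P (Vec.map +_ (Vec.map (s ℕ.*_) a))      ≡⟨ cong (eval P) (Vecₚ.map-∘ +_ (s ℕ.*_) a) ⟨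
    eval P (Vec.map (λ k → + (s ℕ.* k)) a)        ≡⟨ cong (eval P) (Vecₚ.map-cong (ℤₚ.pos-* s) a) ⟩
    eval P (Vec.map (λ k → + s ℤ.* + k) a)        ≡⟨ cong (eval P) (Vecₚ.map-∘ (+ s ℤ.*_) +_ a) ⟩
    eval P (Vec.map (+ s ℤ.*_) (Vec.map +_ a))    ≡⟨ eval-scale (+ s) (Vec.map +_ a) ⟩
    (+ s) ℤ.^ d ℤ.* eval P (Vec.map +_ a)         ≡⟨ cong ((+ s) ℤ.^ d ℤ.*_) root ⟩
    (+ s) ℤ.^ d ℤ.* 0ℤ                            ≡⟨ ℤₚ.*-zeroʳ ((+ s) ℤ.^ d) ⟩
    0ℤ                                            ∎

-- Provides one bound for all entries of a solution, so that only finitely many values of the limit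
-- colouring matter.
all≤sum : (v : Vec ℕ n) → VecAll.All (_≤ Vec.sum v) v
all≤sum []      = []
all≤sum (k ∷ v) =
  ℕₚ.m≤m+n k _ ∷ VecAll.map (λ j≤ → ℕₚ.≤-trans j≤ (ℕₚ.m≤n+m _ k)) (all≤sum v)

-- Induction on the number of sets, splitting off the first one. It serves both piecewise syndetic
-- sets and infinite sets, the latter for the pigeonhole principle.
finite-union : (𝓕 : Pred (Pred ℕ 0ℓ) 0ℓ) →
  (∀ {A B} → A ⊆ B → 𝓕 A → 𝓕 B) →
  ¬ 𝓕 ∅ →
  (∀ {A B} → 𝓕 (A ∪ B) → 𝓕 A ⊎ 𝓕 B) →
  (A : Fin g → Pred ℕ 0ℓ) → 𝓕 (λ k → ∃[ i ] k ∈ A i) → ∃[ i ] 𝓕 (A i)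
finite-union {zero}  𝓕 mono ¬∅ prime A f = ⊥-elim (¬∅ (mono (λ ()) f))
finite-union {suc g} 𝓕 mono ¬∅ prime A f
  with prime (mono (λ { (zero , k∈) → inj₁ k∈ ; (suc i , k∈) → inj₂ (i , k∈) }) f)
... | inj₁ f₀ = zero , f₀
... | inj₂ f₊ = let i , fᵢ = finite-union 𝓕 mono ¬∅ prime (A ∘ suc) f₊ in suc i , fᵢ

-- Piecewise syndetic sets.

All-NonZero-products : ∀ {F H} → All NonZero F → All NonZero H →
  All NonZero (List.cartesianProductWith ℕ._*_ F H)
All-NonZero-products {F} {H} F≢0 H≢0 = All.tabulate λ p →
  let f , h , f∈ , h∈ , eq = ∈-cartesianProductWith⁻ ℕ._*_ F H p
  in subst NonZero (sym eq)
       (ℕₚ.m*n≢0 f h {{All.lookup F≢0 f∈}} {{All.lookup H≢0 h∈}})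

PS-mono : ∀ {A B} → A ⊆ B → PiecewiseSyndetic A → PiecewiseSyndetic B
PS-mono A⊆B (G , G≢[] , G≢0 , thick) = G , G≢[] , G≢0 , λ F F≢0 →
  let x , x≢0 , Fx = thick F F≢0 in x , x≢0 , All.map (Any.map A⊆B) Fx

¬PS-∅ : ¬ PiecewiseSyndetic ∅
¬PS-∅ (_ , _ , _ , thick) with thick (1 ∷ []) (_ ∷ [])
... | _ , _ , p ∷ [] = proj₂ (Any.satisfied p)

PS-U : PiecewiseSyndetic U
PS-U = 1 ∷ [] , (λ ()) , _ ∷ [] , λ F _ → 1 , _ , All.tabulate λ _ → here tt

Infinite : Pred (Pred ℕ 0ℓ) 0ℓ
Infinite S = ∀ N → ∃[ M ] N ≤ M × M ∈ S

module Classical (em : ExcludedMiddle 0ℓ) where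

  dec : (Q : Set) → Dec Q
  dec Q = em

  -- If no dilate of F₀ lies in the part of the thick set coming from A, then
  -- every dilate of F₀ inside the thick set meets the part coming from B.
  PS-prime : ∀ {A B} → PiecewiseSyndetic (A ∪ B) → PiecewiseSyndetic A ⊎ PiecewiseSyndetic B
  PS-prime {A} {B} (G , G≢[] , G≢0 , thick)
    with dec (∃[ F ] All NonZero F ×
             (∀ x → NonZero x → ¬ All (λ f → Any (λ t → t ℕ.* (f ℕ.* x) ∈ A) G) F))
  ... | no ¬obstruction = inj₁ (G , G≢[] , G≢0 , thickA)
    where
    thickA : ∀ F → All NonZero F →
      ∃ λ x → NonZero x × All (λ f → Any (λ t → t ℕ.* (f ℕ.* x) ∈ A) G) F
    thickA F F≢0 with dec _
    ... | yes x  = x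
    ... | no  ¬x = ⊥-elim (¬obstruction (F , F≢0 , λ x x≢0 Fx → ¬x (x , x≢0 , Fx)))
  ... | yes (F₀ , F₀≢0 , obstruction) =
    inj₂ (H , H≢[] , All-NonZero-products G≢0 F₀≢0 , thickB)
    where
    -- If `t` sends `f * h * x` into `B`, then `t * h` sends `f * x` into `B`; hence the products of
    -- `G` and `F₀`.
    H = List.cartesianProductWith ℕ._*_ G F₀

    module _ F (F≢0 : All NonZero F) where
      private
        -- Using all products `f * h` puts the whole dilate of `F₀` by `f * x` into the thick set,
        -- for every `f` in `F` at once.
        dilate = thick (List.cartesianProductWith ℕ._*_ F F₀) (All-NonZero-products F≢0 F₀≢0)
        x      = proj₁ dilate
        x≢0    = proj₁ (proj₂ dilate)

      meetsB : ∀ {f} → f ∈ₗ F → Any (λ u → u ℕ.* (f ℕ.* x) ∈ B) H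
      meetsB {f} f∈
        with find (Allₚ.¬All⇒Any¬ (λ _ → dec _) F₀
               (obstruction (f ℕ.* x) (ℕₚ.m*n≢0 f x {{All.lookup F≢0 f∈}} {{x≢0}})))
      ... | h , h∈ , ¬A
        with find (All.lookup (proj₂ (proj₂ dilate)) (∈-cartesianProductWith⁺ ℕ._*_ f∈ h∈))
      ... | t , t∈ , inj₁ a = ⊥-elim (¬A (lose t∈ (subst A (cong (t ℕ.*_) fhx≡hfx) a)))
        where
        fhx≡hfx : f ℕ.* h ℕ.* x ≡ h ℕ.* (f ℕ.* x)
        fhx≡hfx = trans (cong (ℕ._* x) (ℕₚ.*-comm f h)) (ℕₚ.*-assoc h f x)
      ... | t , t∈ , inj₂ b = lose (∈-cartesianProductWith⁺ ℕ._*_ t∈ h∈) (subst B eq b)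
        where
        eq : t ℕ.* (f ℕ.* h ℕ.* x) ≡ t ℕ.* h ℕ.* (f ℕ.* x)
        eq = begin
          t ℕ.* (f ℕ.* h ℕ.* x)   ≡⟨ cong (λ y → t ℕ.* (y ℕ.* x)) (ℕₚ.*-comm f h) ⟩
          t ℕ.* (h ℕ.* f ℕ.* x)   ≡⟨ cong (t ℕ.*_) (ℕₚ.*-assoc h f x) ⟩
          t ℕ.* (h ℕ.* (f ℕ.* x)) ≡⟨ ℕₚ.*-assoc t h _ ⟨
          t ℕ.* h ℕ.* (f ℕ.* x)   ∎

      thickB : ∃ λ x → NonZero x × All (λ f → Any (λ u → u ℕ.* (f ℕ.* x) ∈ B) H) F
      thickB = x , x≢0 , All.tabulate meetsB

    H≢[] : H ≢ []
    -- Applied to the single factor 1, `thickB` produces an element of `H`.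
    H≢[] H≡[] with thickB (1 ∷ []) (_ ∷ [])
    ... | _ , _ , p ∷ [] = case subst (Any _) H≡[] p of λ ()

  -- Infinite sets and limits of colourings.

  Infinite-prime : ∀ {A B} → Infinite (A ∪ B) → Infinite A ⊎ Infinite B
  Infinite-prime {A} {B} inf with dec (∃[ N ] ∀ M → N ≤ M → ¬ M ∈ A)
  ... | yes (N₀ , ¬A) = inj₂ infB
    where
    infB : Infinite B
    -- Beyond `N₀` nothing lies in `A`, so an element of the union past both bounds lies in `B`.
    infB N with inf (N ℕ.⊔ N₀)
    ... | M , ≤M , inj₁ a = ⊥-elim (¬A M (ℕₚ.≤-trans (ℕₚ.m≤n⊔m N N₀) ≤M) a)
    ... | M , ≤M , inj₂ b = M , ℕₚ.≤-trans (ℕₚ.m≤m⊔n N N₀) ≤M , b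
  ... | no ¬bounded = inj₁ infA
    where
    infA : Infinite A
    infA N with dec _
    ... | yes M  = M
    ... | no  ¬M = ⊥-elim (¬bounded (N , λ M N≤M a → ¬M (M , N≤M , a)))

  pigeonhole : ∀ {S} (c : ℕ → Fin g) → Infinite S → ∃[ i ] Infinite (S ∩ λ M → c M ≡ i)
  pigeonhole c inf =
    finite-union Infinite
      (λ A⊆B inf N → let M , N≤M , a = inf N in M , N≤M , A⊆B a)
      (λ inf → proj₂ (proj₂ (inf 0)))
      Infinite-prime _
      (λ N → let M , N≤M , s = inf N in M , N≤M , c M , s , refl)

  module Limit (c : ℕ → ℕ → Fin g) where

    -- A decreasing sequence of infinite sets of indices `M`: at stage `k` the pigeonhole principle
    -- selects a value `χ k` that `c M k` takes for infinitely many of the remaining `M`, and only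
    -- these are kept.
    agreeing : ℕ → Σ (Pred ℕ 0ℓ) Infinite
    χ : ℕ → Fin g

    χ k = proj₁ (pigeonhole (λ M → c M k) (proj₂ (agreeing k)))

    agreeing zero    = U , λ N → N , ℕₚ.≤-refl , tt
    agreeing (suc k) =
      (proj₁ (agreeing k) ∩ λ M → c M k ≡ χ k) ,
      proj₂ (pigeonhole (λ M → c M k) (proj₂ (agreeing k)))

    agreeing-spec : ∀ K {M k} → M ∈ proj₁ (agreeing K) → k < K → c M k ≡ χ k
    agreeing-spec (suc K) (M∈ , cMK≡χK) (s≤s k≤K) with ℕₚ.m≤n⇒m<n∨m≡n k≤K
    ... | inj₁ k<K  = agreeing-spec K M∈ k<K
    ... | inj₂ refl = cMK≡χK

    -- Infinitude of `agreeing K` allows `M` to be at least `K`, so that the `M`-th colouring is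
    -- meaningful wherever it is compared with `χ`.
    χ-approximated : ∀ K → ∃[ M ] K ≤ M × (∀ {k} → k < K → c M k ≡ χ k)
    χ-approximated K =
      let M , K≤M , M∈ = proj₂ (agreeing K) K in M , K≤M , agreeing-spec K M∈

  -- The two implications.

  some-cell-PS : ∀ {m} (A : Fin m → Pred ℕ 0ℓ) → IsPartition A → ∃[ i ] PiecewiseSyndetic (A i)
  some-cell-PS A part =
    finite-union PiecewiseSyndetic (λ {A} {B} → PS-mono {A} {B}) ¬PS-∅
      (λ {A} {B} → PS-prime {A} {B}) A
      (PS-mono {U} (λ {k} _ → IsPartition.cover part k) PS-U)

  solution-in-PS : (P : Polynomial n) → Homogeneous P → PartitionRegular P →
    ∀ A → PiecewiseSyndetic A → HasSolutionIn P A
  solution-in-PS P hom pr A ([] , G≢[] , _) = ⊥-elim (G≢[] refl)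
  -- Matching `G` as a nonempty list makes its index type inhabited, as the default value of
  -- `colour` requires.
  solution-in-PS P (d , hom) pr A (G@(_ ∷ _) , _ , G≢0 , thick) =
    let i , a , mono , root = pr (λ i k → χ k ≡ i) record
          { cover = λ k → χ k , refl ; disjoint = λ p q → trans (sym p) q }
        -- The successor makes every entry of `a` lie strictly below the bound, and also below `M`,
        -- hence inside the dilated segment.
        M , a<M , agree = χ-approximated (suc (Vec.sum a))
        -- A colour is a position in `G`. All entries of `a` have colour `i`, so the single factor
        -- `t * x` carries each of them into `A`.
        t = List.lookup G i
        x , x≢0 , _ = dilate M
        scaled : ∀ {k} → (χ k ≡ i × NonZero k) × k ≤ Vec.sum a →
          t ℕ.* x ℕ.* k ∈ A × NonZero (t ℕ.* x ℕ.* k)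
        scaled {k} = λ { ((χk≡i , k≢0) , k≤) →
          subst A (trans (cong (λ j → List.lookup G j ℕ.* (k ℕ.* x))
                               (trans (agree (s≤s k≤)) χk≡i))
                         (tkx≡txk t k x))
            (colour-∈ M k {{k≢0}} (ℕₚ.≤-trans k≤ (ℕₚ.<⇒≤ a<M))) ,
          ℕₚ.m*n≢0 (t ℕ.* x) k
            {{ℕₚ.m*n≢0 t x {{All.lookup G≢0 (∈-lookup i)}} {{x≢0}}}} {{k≢0}} }
    in Vec.map (t ℕ.* x ℕ.*_) a ,
       VecAllₚ.map⁺ (VecAll.map scaled (VecAll.zip (mono , all≤sum a))) ,
       scaled-root P d hom (t ℕ.* x) a root
    where
    dilate : ∀ M → ∃ λ x → NonZero x ×
      All (λ f → Any (λ t → t ℕ.* (f ℕ.* x) ∈ A) G) (List.applyUpTo suc M)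
    dilate M = thick (List.applyUpTo suc M) (Allₚ.applyUpTo⁺₂ suc M _)

    dilation : ℕ → ℕ
    dilation M = proj₁ (dilate M)

    -- Junk value zero when no t works, which can happen only for k = 0 or M < k.
    colour : ℕ → ℕ → Fin (List.length G)
    colour M k with dec (Any (λ t → t ℕ.* (k ℕ.* dilation M) ∈ A) G)
    ... | yes p = Any.index p
    ... | no  _ = zero

    colour-∈ : ∀ M k {{_ : NonZero k}} → k ≤ M →
      List.lookup G (colour M k) ℕ.* (k ℕ.* dilation M) ∈ A
    colour-∈ M k@(suc _) k≤M with dec (Any (λ t → t ℕ.* (k ℕ.* dilation M) ∈ A) G)
    ... | yes p = Anyₚ.lookup-index p
    -- The list enumerates 1 up to `M`, so the entry `k` sits at the predecessor of `k`; `k≤M` says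
    -- that this position is below `M`.
    ... | no ¬p = ⊥-elim (¬p (All.lookup (proj₂ (proj₂ (dilate M))) (∈-applyUpTo⁺ suc k≤M)))

    open Limit colour

    tkx≡txk : ∀ t k x → t ℕ.* (k ℕ.* x) ≡ t ℕ.* x ℕ.* k
    tkx≡txk t k x = trans (cong (t ℕ.*_) (ℕₚ.*-comm k x)) (sym (ℕₚ.*-assoc t x k))

corollary6p14 : ExcludedMiddle 0ℓ →
    ∀ (n : ℕ) (P : Polynomial n) → Homogeneous P →
    PartitionRegular P ⇔ (∀ (A : Pred ℕ 0ℓ) → PiecewiseSyndetic A → HasSolutionIn P A)
corollary6p14 em n P hom = mk⇔
  (solution-in-PS P hom)
  (λ solvable A part → let i , ps = some-cell-PS A part in i , solvable (A i) ps)
  where open Classical em
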